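{- Let $X \in \{\mathrm{LD},\mathrm{LTD},\mathrm{OD},\mathrm{OTD},\mathrm{ID},\mathrm{ITD},\mathrm{FD},\mathrm{FTD}\}$ and let $S\in\{L,O,I,F\}$ be the first letter of $X$ (the type of separation involved in $X$). If $G$ is an X-admissible graph on $n$ vertices with $\gamma^{X}(G)=k$, where $k\ge 2$, then $$n \le \begin{cases} 2^k+k-1 & \text{if } X \in \{\mathrm{LD},\mathrm{LTD}\},\\ 2^k & \text{if } X=\mathrm{OD},\\ 2^k-1 & \text{if } X\in\{\mathrm{OTD},\mathrm{ID},\mathrm{ITD}\},\\ 2^k-k & \text{if } X=\mathrm{FD},\\ 2^k-k-1 & \text{if } X=\mathrm{FTD}.\end{cases}$$ Moreover, equality in the respective case is achieved if and only if $G$ is isomorphic to some graph $G^S(k)=(C\cup (V\setminus C),E)$ such that $G^S(k)[C]$ is X-admissible and, if $X\in\{\mathrm{OD},\mathrm{FD}\}$, $G^S(k)[C]$ has an isolated vertex.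
   Context: Graphs are finite, simple and undirected. For a graph $G=(V,E)$ and $v\in V$, $N(v)$ is the open neighborhood and $N[v]=N(v)\cup\{v\}$ the closed neighborhood; $G[C]$ is the subgraph induced by $C$. Open twins are distinct non-adjacent $u,v$ with $N(u)=N(v)$; closed twins are distinct adjacent $u,v$ with $N[u]=N[v]$. A set $C\subseteq V$ is dominating (resp. total-dominating) if $N[v]\cap C\neq\emptyset$ (resp. $N(v)\cap C\ne\emptyset$) for all $v\in V$. It is location-separating (L-separating) if $N(u)\cap C\neq N(v)\cap C$ for all distinct $u,v\in V\setminus C$; open-separating (O-separating) if $N(u)\cap C\neq N(v)\cap C$ for all distinct $u,v\in V$; closed-separating (I-separating) if $N[u]\cap C\neq N[v]\cap C$ for all distinct $u,v\in V$; full-separating (F-separating) if it is both open- and closed-separating. For $S\in\{L,O,I,F\}$, an $S$D-code (resp. $S$TD-code) is an $S$-separating set that is dominating (resp. total-dominating); this defines LD-, LTD-, OD-, OTD-, ID-, ITD-, FD- and FTD-codes. A graph is X-admissible if it has an X-code; $\gamma^{X}(G)$ is the minimum cardinality of an X-code of $G$. $G^S(k)$ denotes any graph with vertex set $V$ and a subset $C\subseteq V$, $|C|=k$, such that: - $S=L$ ($k\ge2$): $V\setminus C$ consists of exactly one vertex $v_{C'}$ with $N(v_{C'})\cap C=C'$ for each non-empty $C'\subseteq C$; - $S=O$ ($k\ge2$): $G^O(k)[C]$ has no open twins and $V\setminus C$ consists of exactly one vertex $v_{C'}$ with $N(v_{C'})\cap C=C'$ for each non-empty $C'\subseteq C$ such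 that no $u\in C$ has $N(u)\cap C=C'$; - $S=I$ ($k\ge2$): $G^I(k)[C]$ has no closed twins and $V\setminus C$ consists of exactly one vertex $v_{C'}$ with $N(v_{C'})\cap C=C'$ for each non-empty $C'\subseteq C$ such that no $u\in C$ has $N[u]\cap C=C'$; - $S=F$ ($k\ge4$; there are no twin-free graphs on 2 or 3 vertices): $G^F(k)[C]$ has neither open nor closed twins and $V\setminus C$ consists of exactly one vertex $v_{C'}$ with $N(v_{C'})\cap C=C'$ for each non-empty $C'\subseteq C$ such that no $u\in C$ has $N(u)\cap C=C'$ or $N[u]\cap C=C'$. There is no further condition on the edges inside $C$ or inside $V\setminus C$. -}

module Defs where

open import Data.Bool.Base using (Bool; true; false)
open import Data.Empty using (⊥)
open import Data.Fin.Base using (Fin; zero; suc)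
open import Data.Fin.Properties using (suc-injective)
open import Data.Fin.Subset
  using (Subset; inside; outside; _∈_; _∉_; _⊆_; _∩_; _∪_; ⁅_⁆; ∣_∣; Nonempty; Empty)
open import Data.Nat.Base using (ℕ; _+_; _∸_; _^_; _≤_)
open import Data.Product using (∃; ∃!; _×_; _,_)
open import Data.Sum.Base using (_⊎_)
open import Data.Unit.Base using (⊤)
open import Data.Vec.Base using (_∷_; tabulate; here; there)
open import Function.Bundles using (_↔_; Inverse)
open import Relation.Binary.PropositionalEquality using (_≡_; _≢_; refl; cong)
open import Relation.Nullary.Negation.Core using (¬_)

record Graph (n : ℕ) : Set where
  field
    adj        : Fin n → Fin n → Bool
    adj-sym    : ∀ u v → adj u v ≡ adj v u
    adj-irrefl : ∀ v → adj v v ≡ false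

  Adjacent : Fin n → Fin n → Set
  Adjacent u v = adj u v ≡ true

  N : Fin n → Subset n
  N v = tabulate (adj v)

  N[_] : Fin n → Subset n
  N[ v ] = N v ∪ ⁅ v ⁆

  OpenTwins : Fin n → Fin n → Set
  OpenTwins u v = u ≢ v × ¬ Adjacent u v × N u ≡ N v

  ClosedTwins : Fin n → Fin n → Set
  ClosedTwins u v = u ≢ v × Adjacent u v × N[ u ] ≡ N[ v ]

  Isolated : Fin n → Set
  Isolated v = Empty (N v)

HasOpenTwins : ∀ {n} → Graph n → Set
HasOpenTwins G = ∃ λ u → ∃ λ v → Graph.OpenTwins G u v

HasClosedTwins : ∀ {n} → Graph n → Set
HasClosedTwins G = ∃ λ u → ∃ λ v → Graph.ClosedTwins G u v

HasIsolatedVertex : ∀ {n} → Graph n → Set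
HasIsolatedVertex G = ∃ λ v → Graph.Isolated G v

record _≅_ {n m : ℕ} (G : Graph n) (H : Graph m) : Set where
  field
    bijection : Fin n ↔ Fin m
    preserves : ∀ u v →
      Graph.adj G u v ≡ Graph.adj H (Inverse.to bijection u) (Inverse.to bijection v)

infix 4 _≅_

-- The increasing enumeration of the elements of C, which lets G[C] again
-- be a graph on an initial segment of ℕ.

embed : ∀ {n} (C : Subset n) → Fin ∣ C ∣ → Fin n
embed (inside  ∷ C) zero    = zero
embed (inside  ∷ C) (suc i) = suc (embed C i)
embed (outside ∷ C) i       = suc (embed C i)

embed-injective : ∀ {n} (C : Subset n) i j → embed C i ≡ embed C j → i ≡ j
embed-injective (inside  ∷ C) zero    zero    eq = refl
embed-injective (inside  ∷ C) (suc i) (suc j) eq =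
  cong suc (embed-injective C i j (suc-injective eq))
embed-injective (outside ∷ C) i       j       eq =
  embed-injective C i j (suc-injective eq)

embed-∈ : ∀ {n} (C : Subset n) i → embed C i ∈ C
embed-∈ (inside  ∷ C) zero    = here
embed-∈ (inside  ∷ C) (suc i) = there (embed-∈ C i)
embed-∈ (outside ∷ C) i       = there (embed-∈ C i)

embed-surjective : ∀ {n} (C : Subset n) {v} → v ∈ C → ∃ λ i → embed C i ≡ v
embed-surjective (inside  ∷ C) here        = zero , refl
embed-surjective (inside  ∷ C) (there v∈C) with embed-surjective C v∈C
... | i , eq = suc i , cong suc eq
embed-surjective (outside ∷ C) (there v∈C) with embed-surjective C v∈C
... | i , eq = i , cong suc eq

induced : ∀ {n} → Graph n → (C : Subset n) → Graph ∣ C ∣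
induced G C = record
  { adj        = λ i j → adj (embed C i) (embed C j)
  ; adj-sym    = λ i j → adj-sym (embed C i) (embed C j)
  ; adj-irrefl = λ i → adj-irrefl (embed C i)
  }
  where open Graph G

data Domination : Set where
  D TD : Domination

data Separation : Set where
  L O I F : Separation

data CodeType : Set where
  LD LTD OD OTD ID ITD FD FTD : CodeType

separation : CodeType → Separation
separation LD  = L
separation LTD = L
separation OD  = O
separation OTD = O
separation ID  = I
separation ITD = I
separation FD  = F
separation FTD = F

domination : CodeType → Domination
domination LD  = D
domination LTD = TD
domination OD  = D
domination OTD = TD
domination ID  = D
domination ITD = TD
domination FD  = D
domination FTD = TD

module _ {n : ℕ} (G : Graph n) (C : Subset n) where
  open Graph G

  Dominating : Domination → Set
  Dominating D  = ∀ v → Nonempty (N[ v ] ∩ C)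
  Dominating TD = ∀ v → Nonempty (N v ∩ C)

  LocationSeparating : Set
  LocationSeparating = ∀ u v → u ∉ C → v ∉ C → u ≢ v → N u ∩ C ≢ N v ∩ C

  OpenSeparating : Set
  OpenSeparating = ∀ u v → u ≢ v → N u ∩ C ≢ N v ∩ C

  ClosedSeparating : Set
  ClosedSeparating = ∀ u v → u ≢ v → N[ u ] ∩ C ≢ N[ v ] ∩ C

  Separating : Separation → Set
  Separating L = LocationSeparating
  Separating O = OpenSeparating
  Separating I = ClosedSeparating
  Separating F = OpenSeparating × ClosedSeparating

IsCode : ∀ {n} → CodeType → Graph n → Subset n → Set
IsCode X G C = Separating G C (separation X) × Dominating G C (domination X)

Admissible : ∀ {n} → CodeType → Graph n → Set
Admissible X G = ∃ λ C → IsCode X G C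

-- γ^X is only partially defined, hence given as a relation:
-- CodeNumber X G k says that γ^X(G) is defined and equal to k.

record CodeNumber {n : ℕ} (X : CodeType) (G : Graph n) (k : ℕ) : Set where
  field
    attained : ∃ λ C → IsCode X G C × ∣ C ∣ ≡ k
    minimal  : ∀ C → IsCode X G C → k ≤ ∣ C ∣

-- The truncated subtractions are exact for k ≥ 2.

bound : CodeType → ℕ → ℕ
bound LD  k = 2 ^ k + k ∸ 1
bound LTD k = 2 ^ k + k ∸ 1
bound OD  k = 2 ^ k
bound OTD k = 2 ^ k ∸ 1
bound ID  k = 2 ^ k ∸ 1
bound ITD k = 2 ^ k ∸ 1
bound FD  k = 2 ^ k ∸ k
bound FTD k = 2 ^ k ∸ k ∸ 1

minSize : Separation → ℕ
minSize L = 2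
minSize O = 2
minSize I = 2
minSize F = 4

TwinCondition : ∀ {n} → Separation → Graph n → Set
TwinCondition L H = ⊤
TwinCondition O H = ¬ HasOpenTwins H
TwinCondition I H = ¬ HasClosedTwins H
TwinCondition F H = ¬ HasOpenTwins H × ¬ HasClosedTwins H

module _ {n : ℕ} (G : Graph n) (C : Subset n) where
  open Graph G

  -- For u ∈ C, the condition that excludes C′ from the sets indexing V ∖ C.
  Represented : Separation → Subset n → Fin n → Set
  Represented L C′ u = ⊥
  Represented O C′ u = N u ∩ C ≡ C′
  Represented I C′ u = N[ u ] ∩ C ≡ C′
  Represented F C′ u = (N u ∩ C ≡ C′) ⊎ (N[ u ] ∩ C ≡ C′)

  -- The sets C′ for which V ∖ C contains a vertex v_{C′}.
  Index : Separation → Subset n → Set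
  Index S C′ = C′ ⊆ C × Nonempty C′ × ¬ (∃ λ u → u ∈ C × Represented S C′ u)

-- G is a graph G^S(k), with C as its distinguished set of k vertices.

record IsExtremal {n : ℕ} (S : Separation) (k : ℕ) (G : Graph n) (C : Subset n) : Set where
  open Graph G
  field
    size-ok     : minSize S ≤ k
    size        : ∣ C ∣ ≡ k
    twins       : TwinCondition S (induced G C)
    unique      : ∀ C′ → Index G C S C′ → ∃! _≡_ (λ v → v ∉ C × N v ∩ C ≡ C′)
    nothingElse : ∀ v → v ∉ C → ∃ λ C′ → Index G C S C′ × N v ∩ C ≡ C′

{-# OPTIONS --safe #-}
module Submission where

-- Send each vertex outside the code C to the trace N(v) ∩ C, and each vertex of
-- C to its trace N(u) ∩ C, N[u] ∩ C, both or none, according to the kind of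
-- separation.  (An open and a closed trace of vertices of C never coincide:
-- N(u) ∩ C = N[v] ∩ C puts v in N(u), hence u in N[v] ∩ C, hence u in N(u).)
-- For a code all these traces are distinct, and unless X is OD or FD none is
-- empty, so that the empty set may be added as one more value.  This gives an
-- injection of spare + copies · k + (n − k) slots into the 2^k subsets of C,
-- which is the bound; equality means that it is onto, that is, that every
-- nonempty subset not taken by C is the trace of an outside vertex.

open import Defs
open import Data.Bool.Base using (Bool; true; false)
open import Data.Bool.Properties using () renaming (_≟_ to _≟ᵇ_)
open import Data.Fin.Base using (Fin; zero; suc; combine)
open import Data.Fin.Patterns using (0F; 1F; 2F)
open import Data.Fin.Permutation using (↔⇒≡)
open import Data.Fin.Properties
  using (_≟_; any?; injective⇒≤; combine-injective; combine-surjective; 2↔Bool; +↔⊎; *↔×)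
open import Data.Fin.Subset
  using (Subset; inside; outside; _∈_; _∉_; _⊆_; _∩_; ∁; ∣_∣; Nonempty; Empty)
  renaming (⊥ to ∅; ⊤ to full)
open import Data.Fin.Subset.Properties
  using ( ∉⊥; ∈⊤; x∈⁅x⁆; x∈⁅y⁆⇒x≡y; x∈p∩q⁺; x∈p∩q⁻; x∈p∪q⁻; x∈p∪q⁺; p⊆p∪q; p∩q⊆q; ⊆-antisym
        ; drop-∷-⊆; ∩-identityʳ; Empty-unique; nonempty?; ∣p∣≤n; ∣∁p∣≡n∸∣p∣; x∈∁p⇒x∉p; x∉p⇒x∈∁p )
open import Data.Nat.Base using (ℕ; zero; suc; _+_; _*_; _∸_; _^_; _≤_; s≤s; z≤n)
open import Data.Nat.Properties
  using ( ≤-reflexive; ≤-trans; ≤-antisym; 1+n≰n; m≤n+m; m≤m+n; m+[n∸m]≡n; m∸n+n≡m; +-identityʳ; +-comm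
        ; +-assoc; +-monoˡ-≤; +-mono-≤; +-cancelʳ-≤; +-cancelʳ-≡; m^n>0; ∸-+-assoc; module ≤-Reasoning )
open import Data.Nat.Tactic.RingSolver using (solve-∀)
open import Data.Product using (∃; ∃!; _×_; _,_; proj₁; proj₂)
open import Data.Sum.Base using (_⊎_; inj₁; inj₂; [_,_]′)
open import Data.Sum.Function.Propositional using (_⊎-↔_)
open import Data.Unit.Base using (tt)
open import Data.Vec.Base using ([]; _∷_; here; there)
open import Data.Vec.Properties using (≡-dec; lookup∘tabulate; []=⇒lookup; lookup⇒[]=; tabulate-cong)
open import Function.Base using (_∘_; id)
open import Function.Bundles using (_⇔_; _↔_; mk⇔; Inverse)
open import Function.Construct.Identity using (↔-id)
open import Function.Definitions using (Injective)
open import Function.Properties.Inverse using (↔-trans)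
open import Relation.Binary.Definitions using (DecidableEquality)
open import Relation.Binary.PropositionalEquality
  using (_≡_; _≢_; refl; sym; trans; cong; cong₂; subst; module ≡-Reasoning)
open import Relation.Nullary.Decidable using (yes; no; decidable-stable)
open import Relation.Nullary.Negation.Core using (¬_; contradiction)

-- Counting the subsets of C

-- One binary digit per element of `C`. Bits of `A` outside `C` are dropped, so this is a bijection
-- only on the subsets of `C`, hence the conditions `A ⊆ C` below.
rank : ∀ {n} (C : Subset n) → Subset n → Fin (2 ^ ∣ C ∣)
rank []            []      = zero
rank (inside  ∷ C) (x ∷ A) = combine (Inverse.from 2↔Bool x) (rank C A)
rank (outside ∷ C) (x ∷ A) = rank C A

rank-injective : ∀ {n} (C : Subset n) {A B} → A ⊆ C → B ⊆ C → rank C A ≡ rank C B → A ≡ B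
rank-injective []            {[]}          {[]}          _   _   _  = refl
rank-injective (inside  ∷ C) {x ∷ A}       {y ∷ B}       A⊆C B⊆C eq
  with x≡y , A≡B ← combine-injective (Inverse.from 2↔Bool x) (rank C A) _ _ eq =
  cong₂ _∷_
    (trans (sym (Inverse.strictlyInverseˡ 2↔Bool x))
           (trans (cong (Inverse.to 2↔Bool) x≡y) (Inverse.strictlyInverseˡ 2↔Bool y)))
    (rank-injective C (drop-∷-⊆ A⊆C) (drop-∷-⊆ B⊆C) A≡B)
rank-injective (outside ∷ C) {inside  ∷ A} {_}           A⊆C _   _  = contradiction (A⊆C here) λ ()
rank-injective (outside ∷ C) {outside ∷ A} {inside  ∷ B} _   B⊆C _  = contradiction (B⊆C here) λ ()
rank-injective (outside ∷ C) {outside ∷ A} {outside ∷ B} A⊆C B⊆C eq =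
  cong (outside ∷_) (rank-injective C (drop-∷-⊆ A⊆C) (drop-∷-⊆ B⊆C) eq)

rank-surjective : ∀ {n} (C : Subset n) i → ∃ λ A → A ⊆ C × rank C A ≡ i
rank-surjective []            zero = [] , id , refl
rank-surjective (inside  ∷ C) i
  with b , j , refl ← combine-surjective {2} {2 ^ ∣ C ∣} i
  with A , A⊆C , refl ← rank-surjective C j =
  Inverse.to 2↔Bool b ∷ A , ∷⊆∷ , cong (λ c → combine c (rank C A)) (Inverse.strictlyInverseʳ 2↔Bool b)
  where
  ∷⊆∷ : ∀ {x} → x ∷ A ⊆ inside ∷ C
  ∷⊆∷ here      = here
  ∷⊆∷ (there p) = there (A⊆C p)
rank-surjective (outside ∷ C) i with A , A⊆C , eq ← rank-surjective C i =
  outside ∷ A , (λ { (there p) → there (A⊆C p) }) , eq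

-- A missed value `y` could be added as the image of one more argument, giving an injection of
-- `Fin (suc m)` into `Fin m`.
injective⇒surjective : ∀ {m n} {f : Fin m → Fin n} → m ≡ n → Injective _≡_ _≡_ f → ∀ y → ∃ λ x → f x ≡ y
injective⇒surjective {m} {f = f} refl f-inj y with any? (λ x → f x ≟ y)
... | yes hit = hit
... | no miss = contradiction (injective⇒≤ g-injective) 1+n≰n
  where
  g : Fin (suc m) → Fin m
  g zero    = y
  g (suc x) = f x

  g-injective : Injective _≡_ _≡_ g
  g-injective {zero}  {zero}  _  = refl
  g-injective {zero}  {suc x} eq = contradiction (x , sym eq) miss
  g-injective {suc x} {zero}  eq = contradiction (x , eq) miss
  g-injective {suc x} {suc z} eq = cong suc (f-inj eq)

-- `enum` lets the members of the family form a sum type, while the counting takes place between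
-- `Fin s` and `Fin (2 ^ ∣ C ∣)`.
module SubsetFamily {n s} {A : Set} (C : Subset n) (enum : Fin s ↔ A)
  (value : A → Subset n) (value⊆C : ∀ a → value a ⊆ C)
  (value-injective : ∀ {a b} → value a ≡ value b → a ≡ b) where

  private
    index : Fin s → Fin (2 ^ ∣ C ∣)
    index = rank C ∘ value ∘ Inverse.to enum

    index-injective : Injective _≡_ _≡_ index
    index-injective {i} {j} eq =
      trans (sym (Inverse.strictlyInverseʳ enum i))
        (trans (cong (Inverse.from enum) (value-injective (rank-injective C (value⊆C _) (value⊆C _) eq)))
               (Inverse.strictlyInverseʳ enum j))

  size≤ : s ≤ 2 ^ ∣ C ∣
  size≤ = injective⇒≤ index-injective

  size≡⇒onto : s ≡ 2 ^ ∣ C ∣ → ∀ {B} → B ⊆ C → ∃ λ a → value a ≡ B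
  size≡⇒onto s≡ {B} B⊆C with i , eq ← injective⇒surjective s≡ index-injective (rank C B) =
    Inverse.to enum i , rank-injective C (value⊆C _) B⊆C eq

  -- Choosing a preimage for each rank gives an injection back into `Fin s`, hence the inequality
  -- opposite to `size≤`.
  onto⇒size≡ : (∀ {B} → B ⊆ C → ∃ λ a → value a ≡ B) → s ≡ 2 ^ ∣ C ∣
  onto⇒size≡ onto = ≤-antisym size≤ (injective⇒≤ section-injective)
    where
    preimage : ∀ i → ∃ λ j → index j ≡ i
    preimage i with B , B⊆C , refl ← rank-surjective C i with a , refl ← onto B⊆C =
      Inverse.from enum a , cong (rank C ∘ value) (Inverse.strictlyInverseˡ enum a)

    section-injective : Injective _≡_ _≡_ (proj₁ ∘ preimage)
    section-injective {i} {j} eq =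
      trans (sym (proj₂ (preimage i))) (trans (cong index eq) (proj₂ (preimage j)))

-- Open and closed neighbourhoods and their traces

-- Both neighbourhoods are handled through one parameter, so that F-separation becomes two instances
-- of the same condition.
data Kind : Set where
  openᴷ closedᴷ : Kind

nbhd : ∀ {n} → Graph n → Kind → Fin n → Subset n
nbhd G openᴷ   = Graph.N G
nbhd G closedᴷ = Graph.N[_] G

module _ {n} (G : Graph n) where
  open Graph G

  adjacent⇒∈N : ∀ {u v} → Adjacent u v → v ∈ N u
  adjacent⇒∈N {u} {v} uv = lookup⇒[]= v (N u) (trans (lookup∘tabulate (adj u) v) uv)

  ∈N⇒adjacent : ∀ {u v} → v ∈ N u → Adjacent u v
  ∈N⇒adjacent {u} {v} v∈N = trans (sym (lookup∘tabulate (adj u) v)) ([]=⇒lookup v∈N)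

  ∈N-sym : ∀ {u v} → v ∈ N u → u ∈ N v
  ∈N-sym {u} {v} v∈N = adjacent⇒∈N (trans (adj-sym v u) (∈N⇒adjacent v∈N))

  ∉N : ∀ v → v ∉ N v
  ∉N v v∈N with () ← trans (sym (adj-irrefl v)) (∈N⇒adjacent v∈N)

  ∈N[] : ∀ v → v ∈ N[ v ]
  ∈N[] v = x∈p∪q⁺ (inj₂ (x∈⁅x⁆ v))

  ∈N[]⁻ : ∀ {u v} → v ∈ N[ u ] → v ∈ N u ⊎ v ≡ u
  ∈N[]⁻ {u} v∈N[] with x∈p∪q⁻ (N u) _ v∈N[]
  ... | inj₁ v∈N = inj₁ v∈N
  ... | inj₂ v∈⁅⁆ = inj₂ (x∈⁅y⁆⇒x≡y u v∈⁅⁆)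

  N⊆nbhd : ∀ κ {v} → N v ⊆ nbhd G κ v
  N⊆nbhd openᴷ   = id
  N⊆nbhd closedᴷ = p⊆p∪q _

  N≢N[] : ∀ {u v} → N u ≢ N[ v ]
  N≢N[] {u} {v} eq = ∉N u (subst (u ∈_) (sym eq) (N⊆nbhd closedᴷ u∈Nv))
    where
    u∈Nv : u ∈ N v
    u∈Nv = ∈N-sym (subst (v ∈_) (sym eq) (∈N[] v))

  -- Applied in `induced G C`, this keeps the open traces of vertices of `C` apart from the closed
  -- ones.
  nbhd-kind : ∀ κ κ′ {u v} → nbhd G κ u ≡ nbhd G κ′ v → κ ≡ κ′
  nbhd-kind openᴷ   openᴷ   _  = refl
  nbhd-kind openᴷ   closedᴷ eq = contradiction eq N≢N[]
  nbhd-kind closedᴷ openᴷ   eq = contradiction (sym eq) N≢N[]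
  nbhd-kind closedᴷ closedᴷ _  = refl

  -- The two neighbourhoods differ only in `v` itself, which the intersection with `C` removes. So
  -- an outside vertex has a single trace, whichever kind is used.
  nbhd∩-outer : ∀ κ {C v} → v ∉ C → nbhd G κ v ∩ C ≡ N v ∩ C
  nbhd∩-outer κ {C} {v} v∉C = ⊆-antisym shrink grow
    where
    grow : N v ∩ C ⊆ nbhd G κ v ∩ C
    grow w∈ with w∈N , w∈C ← x∈p∩q⁻ _ _ w∈ = x∈p∩q⁺ (N⊆nbhd κ w∈N , w∈C)

    narrow : ∀ κ {w} → w ∈ nbhd G κ v → w ∈ C → w ∈ N v
    narrow openᴷ   w∈N   _   = w∈N
    narrow closedᴷ w∈N[] w∈C with ∈N[]⁻ w∈N[]
    ... | inj₁ w∈N  = w∈N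
    ... | inj₂ refl = contradiction w∈C v∉C

    shrink : nbhd G κ v ∩ C ⊆ N v ∩ C
    shrink w∈ with w∈nbhd , w∈C ← x∈p∩q⁻ _ _ w∈ = x∈p∩q⁺ (narrow κ w∈nbhd w∈C , w∈C)

module _ {n} (G : Graph n) (C : Subset n) where

  nbhd-induced⁺ : ∀ κ {i j} → j ∈ nbhd (induced G C) κ i → embed C j ∈ nbhd G κ (embed C i)
  nbhd-induced⁺ openᴷ   j∈N = adjacent⇒∈N G (∈N⇒adjacent (induced G C) j∈N)
  nbhd-induced⁺ closedᴷ j∈N[] with ∈N[]⁻ (induced G C) j∈N[]
  ... | inj₁ j∈N  = N⊆nbhd G closedᴷ (nbhd-induced⁺ openᴷ j∈N)
  ... | inj₂ refl = ∈N[] G _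

  nbhd-induced⁻ : ∀ κ {i j} → embed C j ∈ nbhd G κ (embed C i) → j ∈ nbhd (induced G C) κ i
  nbhd-induced⁻ openᴷ   j∈N = adjacent⇒∈N (induced G C) (∈N⇒adjacent G j∈N)
  nbhd-induced⁻ closedᴷ {i} {j} j∈N[] with ∈N[]⁻ G j∈N[]
  ... | inj₁ j∈N  = N⊆nbhd (induced G C) closedᴷ (nbhd-induced⁻ openᴷ j∈N)
  ... | inj₂ j≡i rewrite embed-injective C j i j≡i = ∈N[] (induced G C) i

  trace⇒induced-⊆ : ∀ κ κ′ {i j} → nbhd G κ (embed C i) ∩ C ≡ nbhd G κ′ (embed C j) ∩ C →
                    nbhd (induced G C) κ i ⊆ nbhd (induced G C) κ′ j
  trace⇒induced-⊆ κ κ′ eq {x} x∈ =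
    nbhd-induced⁻ κ′ (proj₁ (x∈p∩q⁻ _ _
      (subst (embed C x ∈_) eq (x∈p∩q⁺ (nbhd-induced⁺ κ x∈ , embed-∈ C x)))))

  -- The trace of a vertex of `C` is the image under `embed` of its neighbourhood in `induced G C`.
  -- The kinds may differ on the two sides, since open traces are also compared with closed ones.
  trace⇒induced : ∀ κ κ′ {i j} → nbhd G κ (embed C i) ∩ C ≡ nbhd G κ′ (embed C j) ∩ C →
                  nbhd (induced G C) κ i ≡ nbhd (induced G C) κ′ j
  trace⇒induced κ κ′ eq = ⊆-antisym (trace⇒induced-⊆ κ κ′ eq) (trace⇒induced-⊆ κ′ κ (sym eq))

  induced⇒trace-⊆ : ∀ κ κ′ {i j} → nbhd (induced G C) κ i ≡ nbhd (induced G C) κ′ j →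
                    nbhd G κ (embed C i) ∩ C ⊆ nbhd G κ′ (embed C j) ∩ C
  induced⇒trace-⊆ κ κ′ eq x∈
    with x∈nbhd , x∈C ← x∈p∩q⁻ _ _ x∈
    with l , refl ← embed-surjective C x∈C =
    x∈p∩q⁺ (nbhd-induced⁺ κ′ (subst (l ∈_) eq (nbhd-induced⁻ κ x∈nbhd)) , x∈C)

  induced⇒trace : ∀ κ κ′ {i j} → nbhd (induced G C) κ i ≡ nbhd (induced G C) κ′ j →
                  nbhd G κ (embed C i) ∩ C ≡ nbhd G κ′ (embed C j) ∩ C
  induced⇒trace κ κ′ eq = ⊆-antisym (induced⇒trace-⊆ κ κ′ eq) (induced⇒trace-⊆ κ′ κ (sym eq))

-- Twins and separation, one kind of neighbourhood at a time

HasTwins : ∀ {n} → Kind → Graph n → Set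
HasTwins openᴷ   = HasOpenTwins
HasTwins closedᴷ = HasClosedTwins

Separates : ∀ {n} → Graph n → Subset n → Kind → Set
Separates G C κ = ∀ u v → u ≢ v → nbhd G κ u ∩ C ≢ nbhd G κ v ∩ C

-- Equal neighbourhoods settle adjacency. In the open case `v ∈ N u` would give `v ∈ N v`; in the
-- closed case `u ∈ N[ u ]` gives `u ∈ N[ v ]`, hence `u ∈ N v` as the two are distinct.
twinFree⇒injective : ∀ {n} (G : Graph n) κ → ¬ HasTwins κ G → ∀ {u v} → nbhd G κ u ≡ nbhd G κ v → u ≡ v
twinFree⇒injective G κ twinFree {u} {v} eq =
  decidable-stable (u ≟ v) λ u≢v → twinFree (twins κ eq u≢v)
  where
  open Graph G

  twins : ∀ κ → nbhd G κ u ≡ nbhd G κ v → u ≢ v → HasTwins κ G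
  twins openᴷ   eq u≢v =
    u , v , u≢v , (λ uv → ∉N G v (subst (v ∈_) eq (adjacent⇒∈N G uv))) , eq
  twins closedᴷ eq u≢v with ∈N[]⁻ G (subst (u ∈_) eq (∈N[] G u))
  ... | inj₁ u∈Nv = u , v , u≢v , ∈N⇒adjacent G (∈N-sym G u∈Nv) , eq
  ... | inj₂ u≡v  = contradiction u≡v u≢v

separates⇒twinFree : ∀ {n} (G : Graph n) C κ → Separates G C κ → ¬ HasTwins κ (induced G C)
separates⇒twinFree G C openᴷ   sep (i , j , i≢j , _ , eq) =
  sep _ _ (i≢j ∘ embed-injective C i j) (induced⇒trace G C openᴷ openᴷ eq)
separates⇒twinFree G C closedᴷ sep (i , j , i≢j , _ , eq) =
  sep _ _ (i≢j ∘ embed-injective C i j) (induced⇒trace G C closedᴷ closedᴷ eq)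

-- How many traces each vertex of `C` contributes; `kind S` tells which.
copies : Separation → ℕ
copies L = 0
copies O = 1
copies I = 1
copies F = 2

kind : ∀ S → Fin (copies S) → Kind
kind O _       = openᴷ
kind I _       = closedᴷ
kind F zero    = openᴷ
kind F (suc _) = closedᴷ

kind-injective : ∀ S {c c′} → kind S c ≡ kind S c′ → c ≡ c′
kind-injective O {0F} {0F} _ = refl
kind-injective I {0F} {0F} _ = refl
kind-injective F {0F} {0F} _ = refl
kind-injective F {1F} {1F} _ = refl

twinCondition⁻ : ∀ {n} (H : Graph n) S → TwinCondition S H → ∀ c → ¬ HasTwins (kind S c) H
twinCondition⁻ H O free         _  = free
twinCondition⁻ H I free         _  = free
twinCondition⁻ H F (free , _)   0F = free
twinCondition⁻ H F (_ , free)   1F = free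

twinCondition⁺ : ∀ {n} (H : Graph n) S → (∀ c → ¬ HasTwins (kind S c) H) → TwinCondition S H
twinCondition⁺ H L _    = tt
twinCondition⁺ H O free = free 0F
twinCondition⁺ H I free = free 0F
twinCondition⁺ H F free = free 0F , free 1F

module _ {n} (G : Graph n) (C : Subset n) where

  separating⁻ : ∀ S → Separating G C S → ∀ c → Separates G C (kind S c)
  separating⁻ O sep       _  = sep
  separating⁻ I sep       _  = sep
  separating⁻ F (sep , _) 0F = sep
  separating⁻ F (_ , sep) 1F = sep

  separating⁺ : ∀ S → LocationSeparating G C → (∀ c → Separates G C (kind S c)) → Separating G C S
  separating⁺ L loc _   = loc
  separating⁺ O _   sep = sep 0F
  separating⁺ I _   sep = sep 0F
  separating⁺ F _   sep = sep 0F , sep 1F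

  -- For O and F, open separation covers all pairs. For I, the open and closed traces of a vertex
  -- outside `C` coincide.
  separating⇒locating : ∀ S → Separating G C S → LocationSeparating G C
  separating⇒locating L sep = sep
  separating⇒locating O sep = λ u v _ _ → sep u v
  separating⇒locating I sep = λ u v u∉C v∉C u≢v eq → sep u v u≢v
    (trans (nbhd∩-outer G closedᴷ u∉C) (trans eq (sym (nbhd∩-outer G closedᴷ v∉C))))
  separating⇒locating F (sep , _) = λ u v _ _ → sep u v

  represented⁻ : ∀ S {A u} → Represented G C S A u → ∃ λ c → nbhd G (kind S c) u ∩ C ≡ A
  represented⁻ O eq        = 0F , eq
  represented⁻ I eq        = 0F , eq
  represented⁻ F (inj₁ eq) = 0F , eq
  represented⁻ F (inj₂ eq) = 1F , eq

  represented⁺ : ∀ S {A u} c → nbhd G (kind S c) u ∩ C ≡ A → Represented G C S A u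
  represented⁺ O 0F eq = eq
  represented⁺ I 0F eq = eq
  represented⁺ F 0F eq = inj₁ eq
  represented⁺ F 1F eq = inj₂ eq

  dominating⇒N[] : ∀ d → Dominating G C d → Dominating G C D
  dominating⇒N[] D  dom   = dom
  dominating⇒N[] TD dom v with w , w∈ ← dom v with w∈N , w∈C ← x∈p∩q⁻ _ _ w∈ =
    w , x∈p∩q⁺ (N⊆nbhd G closedᴷ w∈N , w∈C)

-- Small twin-free graphs

-- The neighbourhoods can differ only at `u` and `v`. If these are non-adjacent, neither open
-- neighbourhood contains either of them; if adjacent, both closed neighbourhoods contain both.
agreement⇒twins : ∀ {n} (H : Graph n) {u v} → u ≢ v →
                  (∀ w → w ≢ u → w ≢ v → Graph.adj H u w ≡ Graph.adj H v w) →
                  HasOpenTwins H ⊎ HasClosedTwins H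
agreement⇒twins H {u} {v} u≢v agree with Graph.adj H u v in uv
... | false = inj₁ (u , v , u≢v , (λ eq → contradiction (trans (sym uv) eq) λ ()) , tabulate-cong same)
  where
  open Graph H

  same : ∀ w → adj u w ≡ adj v w
  same w with w ≟ u | w ≟ v
  ... | yes refl | _        = trans (adj-irrefl u) (sym (trans (adj-sym v u) uv))
  ... | no _     | yes refl = trans uv (sym (adj-irrefl v))
  ... | no w≢u   | no w≢v   = agree w w≢u w≢v
... | true = inj₂ (u , v , u≢v , uv , ⊆-antisym
    (half (adj-sym v u) agree) (half refl λ w w≢v w≢u → sym (agree w w≢u w≢v)))
  where
  open Graph H

  -- Stated for arbitrary `x` and `y` so that it serves for both inclusions, with `u` and `v`
  -- exchanged.
  half : ∀ {x y} → adj y x ≡ adj u v → (∀ w → w ≢ x → w ≢ y → adj x w ≡ adj y w) → N[ x ] ⊆ N[ y ]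
  half {x} {y} yx agree {w} w∈ with w ≟ x | w ≟ y
  ... | yes refl | _        = N⊆nbhd H closedᴷ (adjacent⇒∈N H (trans yx uv))
  ... | no _     | yes refl = ∈N[] H y
  ... | no w≢x   | no w≢y   with ∈N[]⁻ H w∈
  ...   | inj₁ w∈N = N⊆nbhd H closedᴷ (adjacent⇒∈N H (trans (sym (agree w w≢x w≢y)) (∈N⇒adjacent H w∈N)))
  ...   | inj₂ w≡x = contradiction w≡x w≢x

bool-pigeonhole : ∀ (a b c : Bool) → a ≡ b ⊎ b ≡ c ⊎ a ≡ c
bool-pigeonhole false false _     = inj₁ refl
bool-pigeonhole true  true  _     = inj₁ refl
bool-pigeonhole false true  true  = inj₂ (inj₁ refl)
bool-pigeonhole false true  false = inj₂ (inj₂ refl)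
bool-pigeonhole true  false true  = inj₂ (inj₂ refl)
bool-pigeonhole true  false false = inj₂ (inj₁ refl)

-- There is no third vertex on which the two could disagree.
twins₂ : (H : Graph 2) → HasOpenTwins H ⊎ HasClosedTwins H
twins₂ H = agreement⇒twins H {0F} {1F} (λ ()) λ
  { 0F 0≢0 _   → contradiction refl 0≢0
  ; 1F _   1≢1 → contradiction refl 1≢1 }

-- Two of the three vertex pairs agree on adjacency; they share a vertex, and
-- the other two vertices are twins.
twins₃ : (H : Graph 3) → HasOpenTwins H ⊎ HasClosedTwins H
twins₃ H with bool-pigeonhole (adj 0F 1F) (adj 0F 2F) (adj 1F 2F)
  where open Graph H
... | inj₁ 01≡02 = agreement⇒twins H {1F} {2F} (λ ()) λ
  { 0F _   _   → trans (adj-sym 1F 0F) (trans 01≡02 (adj-sym 0F 2F))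
  ; 1F 1≢1 _   → contradiction refl 1≢1
  ; 2F _   2≢2 → contradiction refl 2≢2 }
  where open Graph H
... | inj₂ (inj₁ 02≡12) = agreement⇒twins H {0F} {1F} (λ ()) λ
  { 0F 0≢0 _   → contradiction refl 0≢0
  ; 1F _   1≢1 → contradiction refl 1≢1
  ; 2F _   _   → 02≡12 }
... | inj₂ (inj₂ 01≡12) = agreement⇒twins H {0F} {2F} (λ ()) λ
  { 0F 0≢0 _   → contradiction refl 0≢0
  ; 1F _   _   → trans 01≡12 (adj-sym 1F 2F)
  ; 2F _   2≢2 → contradiction refl 2≢2 }
  where open Graph H

-- For F an extremal graph must have `4 ≤ k`, while the theorem assumes `2 ≤ k`. Sizes 2 and 3 are
-- ruled out because all graphs of these sizes have twins.
minSize≤ : ∀ S {k} (H : Graph k) → 2 ≤ k → TwinCondition S H → minSize S ≤ k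
minSize≤ L H 2≤k _ = 2≤k
minSize≤ O H 2≤k _ = 2≤k
minSize≤ I H 2≤k _ = 2≤k
minSize≤ F {1} H (s≤s ()) _
minSize≤ F {2} H _ (noOpen , noClosed) = contradiction (twins₂ H) [ noOpen , noClosed ]′
minSize≤ F {3} H _ (noOpen , noClosed) = contradiction (twins₃ H) [ noOpen , noClosed ]′
minSize≤ F {suc (suc (suc (suc k)))} H _ _ = s≤s (s≤s (s≤s (s≤s z≤n)))

-- The slots and their traces

-- This is 1 when the empty set occurs as no trace and may be added as a value. For OD and FD it can
-- be the open trace of an isolated vertex of `induced G C`. An element of `Fin (spare X)` thus
-- serves as evidence that `X` is neither OD nor FD.
spare : CodeType → ℕ
spare LD  = 1
spare LTD = 1
spare OD  = 0
spare OTD = 1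
spare ID  = 1
spare ITD = 1
spare FD  = 0
spare FTD = 1

¬spare : ∀ X → X ≡ OD ⊎ X ≡ FD → ¬ Fin (spare X)
¬spare X (inj₁ refl) ()
¬spare X (inj₂ refl) ()

-- The two sources of the empty set as a value: the spare slot, or the open trace of an isolated
-- vertex of `induced G C`.
spare-or-open : ∀ X → Fin (spare X) ⊎ ((X ≡ OD ⊎ X ≡ FD) × ∃ λ c → kind (separation X) c ≡ openᴷ)
spare-or-open LD  = inj₁ 0F
spare-or-open LTD = inj₁ 0F
spare-or-open OD  = inj₂ (inj₁ refl , 0F , refl)
spare-or-open OTD = inj₁ 0F
spare-or-open ID  = inj₁ 0F
spare-or-open ITD = inj₁ 0F
spare-or-open FD  = inj₂ (inj₂ refl , 0F , refl)
spare-or-open FTD = inj₁ 0F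

spare-unique : ∀ X (z z′ : Fin (spare X)) → z ≡ z′
spare-unique LD  0F 0F = refl
spare-unique LTD 0F 0F = refl
spare-unique OTD 0F 0F = refl
spare-unique ID  0F 0F = refl
spare-unique ITD 0F 0F = refl
spare-unique FTD 0F 0F = refl

-- The two reasons for a trace of a vertex of `C` to be non-empty: total domination provides a
-- neighbour in `C`, and a closed trace contains the vertex itself.
spare⇒nonempty-kinds : ∀ X → Fin (spare X) → ∀ c → domination X ≡ TD ⊎ kind (separation X) c ≡ closedᴷ
spare⇒nonempty-kinds OTD _ _ = inj₁ refl
spare⇒nonempty-kinds ID  _ _ = inj₂ refl
spare⇒nonempty-kinds ITD _ _ = inj₁ refl
spare⇒nonempty-kinds FTD _ _ = inj₁ refl

-- Arithmetic of the bounds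

k<2^k : ∀ k → suc k ≤ 2 ^ k
k<2^k zero    = s≤s z≤n
k<2^k (suc k) = begin
  1 + suc k          ≤⟨ +-mono-≤ (m^n>0 2 k) (k<2^k k) ⟩
  2 ^ k + 2 ^ k      ≡⟨ cong (2 ^ k +_) (+-identityʳ (2 ^ k)) ⟨
  2 ^ suc k          ∎
  where open ≤-Reasoning

-- With the bound in place of n, this says that there are 2^k slots. Everything is moved into sums,
-- so that truncated subtraction can be cancelled once and for all.
bound-slots : ∀ X k → bound X k + (spare X + copies (separation X) * k) ≡ 2 ^ k + k
bound-slots X k = exact X
  where
  k<b : suc k ≤ 2 ^ k
  k<b = k<2^k k

  k≤b : k ≤ 2 ^ k
  k≤b = ≤-trans (m≤n+m k 1) k<b

  location : 2 ^ k + k ∸ 1 + 1 ≡ 2 ^ k + k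
  location = m∸n+n≡m (≤-trans (m^n>0 2 k) (m≤m+n _ k))

  single : 2 ^ k ∸ 1 + (1 + (k + 0)) ≡ 2 ^ k + k
  single = begin
    2 ^ k ∸ 1 + (1 + (k + 0))    ≡⟨ +-assoc (2 ^ k ∸ 1) 1 (k + 0) ⟨
    2 ^ k ∸ 1 + 1 + (k + 0)      ≡⟨ cong₂ _+_ (m∸n+n≡m (m^n>0 2 k)) (+-identityʳ k) ⟩
    2 ^ k + k                    ∎
    where open ≡-Reasoning

  exact : ∀ X → bound X k + (spare X + copies (separation X) * k) ≡ 2 ^ k + k
  exact LD  = location
  exact LTD = location
  exact OD  = cong (2 ^ k +_) (+-identityʳ k)
  exact OTD = single
  exact ID  = single
  exact ITD = single
  exact FD  = begin
    2 ^ k ∸ k + (k + (k + 0))    ≡⟨ +-assoc (2 ^ k ∸ k) k (k + 0) ⟨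
    2 ^ k ∸ k + k + (k + 0)      ≡⟨ cong₂ _+_ (m∸n+n≡m k≤b) (+-identityʳ k) ⟩
    2 ^ k + k                    ∎
    where open ≡-Reasoning
  -- The two subtractions are merged into one of `k + 1`, which is exact because `suc k ≤ 2 ^ k`.
  exact FTD = begin
    2 ^ k ∸ k ∸ 1 + (1 + (k + (k + 0)))  ≡⟨ cong (_+ (1 + (k + (k + 0)))) (∸-+-assoc (2 ^ k) k 1) ⟩
    2 ^ k ∸ (k + 1) + (1 + (k + (k + 0))) ≡⟨ regroup (2 ^ k ∸ (k + 1)) k ⟩
    2 ^ k ∸ (k + 1) + (k + 1) + k        ≡⟨ cong (_+ k) (m∸n+n≡m (≤-trans (≤-reflexive (+-comm k 1)) k<b)) ⟩
    2 ^ k + k                            ∎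
    where
    open ≡-Reasoning
    regroup : ∀ x k → x + (1 + (k + (k + 0))) ≡ x + (k + 1) + k
    regroup = solve-∀

-- Distinct traces and the slot count

_≟ˢ_ : ∀ {n} → DecidableEquality (Subset n)
_≟ˢ_ = ≡-dec _≟ᵇ_

-- What the slot count needs. It holds for a code of any graph and also for the set `C` of an
-- extremal graph with `induced G C` X-admissible, so both directions of the equality case share the
-- count.
record DistinctTraces {n} (X : CodeType) (G : Graph n) (C : Subset n) : Set where
  open Graph G
  field
    twinFree        : TwinCondition (separation X) (induced G C)
    nonisolated     : domination X ≡ TD → ∀ i → Nonempty (Graph.N (induced G C) i)
    outer-injective : ∀ {v w} → v ∉ C → w ∉ C → N v ∩ C ≡ N w ∩ C → v ≡ w
    outer-nonempty  : ∀ {v} → v ∉ C → Nonempty (N v ∩ C)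
    outer-fresh     : ∀ {u v} → u ∈ C → v ∉ C → ∀ c → nbhd G (kind (separation X) c) u ∩ C ≢ N v ∩ C

module Slots {n X} {G : Graph n} {C : Subset n} (traces : DistinctTraces X G C) where
  open Graph G
  open DistinctTraces traces

  private
    S = separation X
    H = induced G C

  Slot : Set
  Slot = Fin (spare X) ⊎ (Fin (copies S) × Fin ∣ C ∣) ⊎ Fin ∣ ∁ C ∣

  #slots : ℕ
  #slots = spare X + (copies S * ∣ C ∣ + ∣ ∁ C ∣)

  enum : Fin #slots ↔ Slot
  enum = ↔-trans +↔⊎ (↔-id _ ⊎-↔ ↔-trans +↔⊎ (*↔× ⊎-↔ ↔-id _))

  value : Slot → Subset n
  value (inj₁ _)              = ∅
  value (inj₂ (inj₁ (c , i))) = nbhd G (kind S c) (embed C i) ∩ C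
  value (inj₂ (inj₂ j))       = N (embed (∁ C) j) ∩ C

  value⊆C : ∀ s → value s ⊆ C
  value⊆C (inj₁ _)              x∈ = contradiction x∈ ∉⊥
  value⊆C (inj₂ (inj₁ (c , i))) = p∩q⊆q _ C
  value⊆C (inj₂ (inj₂ j))       = p∩q⊆q _ C

  outer : ∀ j → embed (∁ C) j ∉ C
  outer j = x∈∁p⇒x∉p (embed-∈ (∁ C) j)

  inner-nonempty : Fin (spare X) → ∀ c i → Nonempty (nbhd G (kind S c) (embed C i) ∩ C)
  inner-nonempty z c i with spare⇒nonempty-kinds X z c
  ... | inj₁ total with j , j∈ ← nonisolated total i =
    embed C j , x∈p∩q⁺ (N⊆nbhd G (kind S c) (nbhd-induced⁺ G C openᴷ j∈) , embed-∈ C j)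
  ... | inj₂ closed rewrite closed = embed C i , x∈p∩q⁺ (∈N[] G _ , embed-∈ C i)

  ∅-not : ∀ {A : Subset n} → Nonempty A → ∅ ≢ A
  ∅-not (_ , x∈A) refl = ∉⊥ x∈A

  value-injective : ∀ {s t} → value s ≡ value t → s ≡ t
  value-injective {inj₁ z} {inj₁ z′} _ = cong inj₁ (spare-unique X z z′)
  value-injective {inj₁ z} {inj₂ (inj₁ (c , i))} eq = contradiction eq (∅-not (inner-nonempty z c i))
  value-injective {inj₁ z} {inj₂ (inj₂ j)} eq = contradiction eq (∅-not (outer-nonempty (outer j)))
  value-injective {inj₂ (inj₁ (c , i))} {inj₁ z} eq = contradiction (sym eq) (∅-not (inner-nonempty z c i))
  value-injective {inj₂ (inj₂ j)} {inj₁ z} eq = contradiction (sym eq) (∅-not (outer-nonempty (outer j)))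
  value-injective {inj₂ (inj₁ (c , i))} {inj₂ (inj₂ j)} eq =
    contradiction eq (outer-fresh (embed-∈ C i) (outer j) c)
  value-injective {inj₂ (inj₂ j)} {inj₂ (inj₁ (c , i))} eq =
    contradiction (sym eq) (outer-fresh (embed-∈ C i) (outer j) c)
  value-injective {inj₂ (inj₂ j)} {inj₂ (inj₂ j′)} eq =
    cong (inj₂ ∘ inj₂) (embed-injective (∁ C) j j′ (outer-injective (outer j) (outer j′) eq))
  -- The equality is carried over to `induced G C`, where the neighbourhood determines its kind,
  -- hence `c`; then twin-freeness determines the vertex.
  value-injective {inj₂ (inj₁ (c , i))} {inj₂ (inj₁ (c′ , i′))} eq
    with eq′ ← trace⇒induced G C (kind S c) (kind S c′) eq
    with refl ← kind-injective S (nbhd-kind H (kind S c) (kind S c′) eq′)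
    with refl ← twinFree⇒injective H (kind S c) (twinCondition⁻ H S twinFree c) eq′ = refl

  open SubsetFamily C enum value value⊆C value-injective public

  -- A set that needs an outside vertex must be the value of an outer slot: the spare slot gives
  -- only the empty set, and an inner slot would make it represented.
  onto⇒extremal : 2 ≤ ∣ C ∣ → (∀ {A} → A ⊆ C → ∃ λ s → value s ≡ A) → IsExtremal S ∣ C ∣ G C
  onto⇒extremal 2≤k onto = record
    { size-ok     = minSize≤ S H 2≤k twinFree
    ; size        = refl
    ; twins       = twinFree
    ; unique      = unique
    ; nothingElse = λ v v∉C → N v ∩ C , (p∩q⊆q _ C , outer-nonempty v∉C , fresh v∉C) , refl
    }
    where
    fresh : ∀ {v} → v ∉ C → ¬ ∃ λ u → u ∈ C × Represented G C S (N v ∩ C) u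
    fresh v∉C (u , u∈C , rep) with c , eq ← represented⁻ G C S rep = outer-fresh u∈C v∉C c eq

    unique : ∀ A → Index G C S A → ∃! _≡_ λ v → v ∉ C × N v ∩ C ≡ A
    unique A (A⊆C , A≢∅ , unrepresented) with onto A⊆C
    ... | inj₁ _ , eq              = contradiction eq (∅-not A≢∅)
    ... | inj₂ (inj₁ (c , i)) , eq = contradiction (_ , embed-∈ C i , represented⁺ G C S c eq) unrepresented
    ... | inj₂ (inj₂ j) , eq       =
      embed (∁ C) j , (outer j , eq) , λ { (v∉C , eq′) → outer-injective (outer j) v∉C (trans eq (sym eq′)) }

  -- For OD and FD there is no spare slot and outer traces are non-empty, so the empty set is the
  -- trace of a vertex of `C`, which then has no neighbour in `C`.
  onto⇒isolated : (∀ {A} → A ⊆ C → ∃ λ s → value s ≡ A) → X ≡ OD ⊎ X ≡ FD → HasIsolatedVertex H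
  onto⇒isolated onto OD⊎FD with onto {∅} (λ x∈ → contradiction x∈ ∉⊥)
  ... | inj₁ z , _               = contradiction z (¬spare X OD⊎FD)
  ... | inj₂ (inj₂ j) , eq       = contradiction (sym eq) (∅-not (outer-nonempty (outer j)))
  ... | inj₂ (inj₁ (c , i)) , eq = i , λ { (j , j∈) →
    ∉⊥ (subst (embed C j ∈_) eq (x∈p∩q⁺ (N⊆nbhd G (kind S c) (nbhd-induced⁺ G C openᴷ j∈) , embed-∈ C j))) }

  extremal⇒onto : ∀ {k} → IsExtremal S k G C → (X ≡ OD ⊎ X ≡ FD → HasIsolatedVertex H) →
                  ∀ {A} → A ⊆ C → ∃ λ s → value s ≡ A
  extremal⇒onto ext isolated {A} A⊆C with nonempty? A
  ... | no A≡∅ rewrite Empty-unique A≡∅ = empty (spare-or-open X)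
    where
    empty : Fin (spare X) ⊎ ((X ≡ OD ⊎ X ≡ FD) × ∃ λ c → kind S c ≡ openᴷ) → ∃ λ s → value s ≡ ∅
    empty (inj₁ z) = inj₁ z , refl
    empty (inj₂ (OD⊎FD , c , isOpen)) with i , alone ← isolated OD⊎FD =
      inj₂ (inj₁ (c , i)) , trans (cong (λ κ → nbhd G κ (embed C i) ∩ C) isOpen) (Empty-unique none)
      where
      none : Empty (N (embed C i) ∩ C)
      none (x , x∈) with x∈N , x∈C ← x∈p∩q⁻ _ _ x∈ with j , refl ← embed-surjective C x∈C =
        alone (j , nbhd-induced⁻ G C openᴷ x∈N)
  -- Search through the inner slots: either one has value `A`, or `A` is an index set and `unique`
  -- supplies an outside vertex.
  ... | yes A≢∅ with any? (λ c → any? (λ i → (nbhd G (kind S c) (embed C i) ∩ C) ≟ˢ A))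
  ...   | yes (c , i , eq) = inj₂ (inj₁ (c , i)) , eq
  ...   | no unrepresented
    with v , (v∉C , eq) , _ ← IsExtremal.unique ext A (A⊆C , A≢∅ , λ { (u , u∈C , rep) →
           let (c , eq) = represented⁻ G C S rep ; (i , i≡u) = embed-surjective C u∈C
           in unrepresented (c , i , trans (cong (λ w → nbhd G (kind S c) w ∩ C) i≡u) eq) })
    with j , refl ← embed-surjective (∁ C) (x∉p⇒x∈∁p v∉C) = inj₂ (inj₂ j) , eq

  -- Intersecting with the whole vertex set changes nothing, so separation follows from
  -- twin-freeness, and total domination from the absence of isolated vertices.
  code-induced : IsCode X H full
  code-induced = separating⁺ H full S (λ _ _ u∉ _ _ → contradiction ∈⊤ u∉) separates
               , dominating (domination X) nonisolated
    where
    separates : ∀ c → Separates H full (kind S c)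
    separates c u v u≢v eq = u≢v (twinFree⇒injective H (kind S c) (twinCondition⁻ H S twinFree c)
      (trans (sym (∩-identityʳ _)) (trans eq (∩-identityʳ _))))

    dominating : ∀ d → (d ≡ TD → ∀ i → Nonempty (Graph.N H i)) → Dominating H full d
    dominating D  _  v = v , x∈p∩q⁺ (∈N[] H v , ∈⊤)
    dominating TD ne v with w , w∈N ← ne refl v = w , x∈p∩q⁺ (w∈N , ∈⊤)

  -- Splitting n into `C` and its complement; the form matches `bound-slots`, so that bound and
  -- vertex number can be compared by cancellation.
  n+spare≡#slots+k : n + (spare X + copies S * ∣ C ∣) ≡ #slots + ∣ C ∣
  n+spare≡#slots+k =
    trans (cong (_+ (spare X + copies S * ∣ C ∣)) (sym ∣C∣+∣∁C∣≡n))
          (regroup ∣ C ∣ ∣ ∁ C ∣ (spare X) (copies S * ∣ C ∣))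
    where
    ∣C∣+∣∁C∣≡n : ∣ C ∣ + ∣ ∁ C ∣ ≡ n
    ∣C∣+∣∁C∣≡n = trans (cong (∣ C ∣ +_) (∣∁p∣≡n∸∣p∣ C)) (m+[n∸m]≡n (∣p∣≤n C))

    regroup : ∀ k q e p → (k + q) + (e + p) ≡ (e + (p + q)) + k
    regroup = solve-∀

  n≤bound : n ≤ bound X ∣ C ∣
  n≤bound = +-cancelʳ-≤ (spare X + copies S * ∣ C ∣) n _ (begin
    n + (spare X + copies S * ∣ C ∣)               ≡⟨ n+spare≡#slots+k ⟩
    #slots + ∣ C ∣                                 ≤⟨ +-monoˡ-≤ ∣ C ∣ size≤ ⟩
    2 ^ ∣ C ∣ + ∣ C ∣                              ≡⟨ bound-slots X ∣ C ∣ ⟨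
    bound X ∣ C ∣ + (spare X + copies S * ∣ C ∣)   ∎)
    where open ≤-Reasoning

  n≡bound⇒onto : n ≡ bound X ∣ C ∣ → ∀ {A} → A ⊆ C → ∃ λ s → value s ≡ A
  n≡bound⇒onto n≡ = size≡⇒onto (+-cancelʳ-≡ ∣ C ∣ #slots _ (begin
    #slots + ∣ C ∣                                 ≡⟨ n+spare≡#slots+k ⟨
    n + (spare X + copies S * ∣ C ∣)               ≡⟨ cong (_+ (spare X + copies S * ∣ C ∣)) n≡ ⟩
    bound X ∣ C ∣ + (spare X + copies S * ∣ C ∣)   ≡⟨ bound-slots X ∣ C ∣ ⟩
    2 ^ ∣ C ∣ + ∣ C ∣                              ∎))
    where open ≡-Reasoning

  onto⇒n≡bound : (∀ {A} → A ⊆ C → ∃ λ s → value s ≡ A) → n ≡ bound X ∣ C ∣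
  onto⇒n≡bound onto = +-cancelʳ-≡ (spare X + copies S * ∣ C ∣) n _ (begin
    n + (spare X + copies S * ∣ C ∣)               ≡⟨ n+spare≡#slots+k ⟩
    #slots + ∣ C ∣                                 ≡⟨ cong (_+ ∣ C ∣) (onto⇒size≡ onto) ⟩
    2 ^ ∣ C ∣ + ∣ C ∣                              ≡⟨ bound-slots X ∣ C ∣ ⟨
    bound X ∣ C ∣ + (spare X + copies S * ∣ C ∣)   ∎)
    where open ≡-Reasoning

-- Codes and extremal graphs have distinct traces

code⇒distinctTraces : ∀ {n} X (G : Graph n) (C : Subset n) → IsCode X G C → DistinctTraces X G C
code⇒distinctTraces X G C (sep , dom) = record
  { twinFree        = twinCondition⁺ (induced G C) S λ c → separates⇒twinFree G C (kind S c) (separates c)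
  ; nonisolated     = λ total i → nonisolated (subst (Dominating G C) total dom) i
  ; outer-injective = λ {v} {w} v∉C w∉C eq → decidable-stable (v ≟ w) λ v≢w →
                        separating⇒locating G C S sep v w v∉C w∉C v≢w eq
  ; outer-nonempty  = λ {v} v∉C → subst Nonempty (nbhd∩-outer G closedᴷ v∉C)
                        (dominating⇒N[] G C (domination X) dom v)
  -- The open trace of `v` is also its trace of kind `kind S c`, so separation of that kind applies
  -- to `u` and `v`.
  ; outer-fresh     = λ {u} {v} u∈C v∉C c eq → separates c u v (λ { refl → v∉C u∈C })
                        (trans eq (sym (nbhd∩-outer G (kind S c) v∉C)))
  }
  where
  open Graph G
  S = separation X

  separates : ∀ c → Separates G C (kind S c)
  separates = separating⁻ G C S sep

  nonisolated : Dominating G C TD → ∀ i → Nonempty (Graph.N (induced G C) i)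
  nonisolated total i
    with w , w∈ ← total (embed C i)
    with w∈N , w∈C ← x∈p∩q⁻ _ _ w∈
    with j , refl ← embed-surjective C w∈C = j , nbhd-induced⁻ G C openᴷ w∈N

-- Admissibility of `induced G C` supplies `nonisolated`: a total-dominating set meets every open
-- neighbourhood. The facts about outside vertices come from the index sets of their traces.
extremal⇒distinctTraces : ∀ {n k} X (G : Graph n) (C : Subset n) → IsExtremal (separation X) k G C →
                          Admissible X (induced G C) → DistinctTraces X G C
extremal⇒distinctTraces X G C ext (C′ , _ , dom) = record
  { twinFree        = twins
  ; nonisolated     = λ total i → let (j , j∈) = subst (Dominating (induced G C) C′) total dom i
                                  in j , proj₁ (x∈p∩q⁻ _ _ j∈)
  ; outer-injective = outer-injective
  ; outer-nonempty  = λ {v} v∉C → let (_ , (_ , A≢∅ , _) , eq) = nothingElse v v∉C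
                                  in subst Nonempty (sym eq) A≢∅
  ; outer-fresh     = λ {u} {v} u∈C v∉C c eq′ → let (_ , (_ , _ , unrepresented) , eq) = nothingElse v v∉C
                      in unrepresented (u , u∈C , represented⁺ G C (separation X) c (trans eq′ eq))
  }
  where
  open Graph G
  open IsExtremal ext

  outer-injective : ∀ {v w} → v ∉ C → w ∉ C → N v ∩ C ≡ N w ∩ C → v ≡ w
  outer-injective {v} {w} v∉C w∉C v~w
    with A , ix , eq ← nothingElse v v∉C
    with x , _ , x-unique ← unique A ix =
    trans (sym (x-unique (v∉C , eq))) (x-unique (w∉C , trans (sym v~w) eq))

-- The bounds and the case of equality

≅-refl : ∀ {n} (G : Graph n) → G ≅ G
≅-refl G = record { bijection = ↔-id _ ; preserves = λ _ _ → refl }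

corollary2 : ∀ (X : CodeType) (n : ℕ) (G : Graph n) (k : ℕ) →
    Admissible X G → CodeNumber X G k → 2 ≤ k →
    (n ≤ bound X k) ×
    (n ≡ bound X k ⇔
    (∃ λ (m : ℕ) → ∃ λ (H : Graph m) → ∃ λ (C : Subset m) →
    IsExtremal (separation X) k H C ×
    Admissible X (induced H C) ×
    (X ≡ OD ⊎ X ≡ FD → HasIsolatedVertex (induced H C)) ×
    G ≅ H))
-- Matching on the size identifies `k` with the size of a minimum code `C`.
corollary2 X n G k _ γ 2≤k with C , code , refl ← CodeNumber.attained γ =
  n≤bound , mk⇔
    -- `G` itself is the extremal graph, with the minimum code as its set `C`.
    (λ n≡bound → let onto = n≡bound⇒onto n≡bound in
      n , G , C , onto⇒extremal 2≤k onto , (full , code-induced) , onto⇒isolated onto , ≅-refl G)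
    -- Isomorphic graphs have equally many vertices, so it is enough to count those of `H`.
    λ { (m , H , C′ , ext , admissible , isolated , G≅H) → trans (↔⇒≡ (_≅_.bijection G≅H))
          (attains H C′ ext admissible isolated) }
  where
  open Slots (code⇒distinctTraces X G C code)

  attains : ∀ {m k} (H : Graph m) C′ → IsExtremal (separation X) k H C′ → Admissible X (induced H C′) →
            (X ≡ OD ⊎ X ≡ FD → HasIsolatedVertex (induced H C′)) → m ≡ bound X k
  attains H C′ ext admissible isolated with refl ← IsExtremal.size ext =
    H.onto⇒n≡bound (H.extremal⇒onto ext isolated)
    where module H = Slots (extremal⇒distinctTraces X H C′ ext admissible)
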